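{- For every integer $n\ge 3$, the transposition Cayley graph $Sym_n(T)$ satisfies $N(Sym_n(T),1)=3$.
   Context: For an integer $n$, $Sym_n$ is the symmetric group on $\{1,\dots,n\}$. The transposition Cayley graph $Sym_n(T)$ is the graph with vertex set $Sym_n$ and edges $\{g,gs\}$ for $g\in Sym_n$, $s\in T$, where $T=\{t_{i,j}: 1\le i<j\le n\}$ is the set of all transpositions ($t_{i,j}$ is the transposition interchanging $i$ and $j$). For a finite connected simple graph $\Gamma$ with vertex set $V(\Gamma)$ and path distance $d$, let $B_r(x)=\{y\in V(\Gamma): d(x,y)\le r\}$ and $$N(\Gamma,r)=\max_{x,y\in V(\Gamma),\ x\ne y}|B_r(x)\cap B_r(y)|.$$ -}

module Defs where

open import Data.Fin.Base as Fin using (Fin; zero; suc)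
import Data.Fin.Properties as Fin
open import Data.Fin.Permutation as Perm
  using (Permutation′; _⟨$⟩ʳ_; _∘ₚ_; transpose; flip; insert; remove; insert-remove; inverseʳ)
import Data.Fin.Permutation.Components as PC
open import Data.Fin.Permutation.Transposition.List using (TranspositionList; eval; decompose; eval-decompose)
open import Data.List.Base using (List; []; _∷_; map; filter; length; deduplicate; allFin; cartesianProduct; cartesianProductWith)
open import Data.List.Extrema.Nat using (max)
import Data.List.Membership.Setoid.Properties as Membership
import Data.List.Membership.Propositional.Properties as ≡-Membership
open import Data.List.Relation.Unary.Any as Any using (Any; here)
open import Data.List.Relation.Unary.Enumerates.Setoid using (IsEnumeration)
open import Data.Nat.Base as ℕ using (ℕ; zero; suc; _≤_; z≤n; s≤s)
import Data.Nat.Properties as ℕ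
open import Data.Product.Base using (∃; ∃₂; _×_; _,_; proj₁; proj₂)
open import Function.Base using (_∘_)
open import Function.Bundles using (Injection)
open import Function.Properties.Inverse using (↔⇒↣)
open import Level using (0ℓ)
open import Relation.Binary.Bundles using (DecSetoid)
open import Relation.Binary.Core using (Rel)
open import Relation.Binary.Definitions using (Symmetric; Irreflexive; _Respects₂_; tri<; tri≈; tri>)
  renaming (Decidable to Decidable₂)
open import Relation.Binary.PropositionalEquality
  using (_≡_; _≢_; refl; sym; trans; cong; setoid)
open import Relation.Nullary.Decidable using (yes; no; ¬?; _×-dec_; map′)
open import Relation.Nullary.Negation using (contradiction)
open import Relation.Unary using (Pred; Decidable)
open import Relation.Unary.Properties using (_∩?_)

least : ∀ {P : Pred ℕ 0ℓ} → Decidable P → ∀ {n} → P n → ∃ λ k → P k × (∀ m → P m → k ≤ m)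
least P? {n} p with P? 0
... | yes p₀ = 0 , p₀ , λ _ _ → z≤n
least P? {zero}  p | no ¬p₀ = contradiction p ¬p₀
least {P} P? {suc n} p | no ¬p₀ with least (P? ∘ suc) {n} p
... | k , pk , min = suc k , pk , minimal
  where
  minimal : ∀ m → P m → suc k ≤ m
  minimal zero    pm = contradiction pm ¬p₀
  minimal (suc m) pm = s≤s (min m pm)

module _ (S : DecSetoid 0ℓ 0ℓ) where
  open DecSetoid S using (Carrier; _≈_)

  -- Walk Adj x y k : a walk of length k from x to y.
  data Walk (Adj : Rel Carrier 0ℓ) : Carrier → Carrier → ℕ → Set where
    stop : ∀ {x y} → x ≈ y → Walk Adj x y 0
    step : ∀ {x y z k} → Adj x y → Walk Adj y z k → Walk Adj x z (suc k)

-- The equality of the vertex setoid is the equality of vertices.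
record FiniteConnectedSimpleGraph : Set₁ where
  field
    vertexSetoid : DecSetoid 0ℓ 0ℓ

  open DecSetoid vertexSetoid public
    using (_≈_; _≟_)
    renaming (Carrier to Vertex; setoid to S; refl to ≈-refl; sym to ≈-sym; trans to ≈-trans)

  field
    Adj            : Rel Vertex 0ℓ
    Adj-resp       : Adj Respects₂ _≈_
    Adj-sym        : Symmetric Adj
    Adj-irrefl     : Irreflexive _≈_ Adj
    Adj?           : Decidable₂ Adj
    -- Repetitions are allowed here.
    vertices       : List Vertex
    isEnumeration  : IsEnumeration S vertices
    connected      : ∀ x y → ∃ (Walk vertexSetoid Adj x y)

  walk-respˡ : ∀ {x x′ y k} → x ≈ x′ → Walk vertexSetoid Adj x y k → Walk vertexSetoid Adj x′ y k
  walk-respˡ x≈x′ (stop x≈y) = stop (≈-trans (≈-sym x≈x′) x≈y)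
  walk-respˡ x≈x′ (step a w) = step (proj₂ Adj-resp x≈x′ a) w

  walk? : ∀ x y → Decidable (Walk vertexSetoid Adj x y)
  walk? x y zero = map′ stop (λ { (stop x≈y) → x≈y }) (x ≟ y)
  walk? x z (suc k) = map′ to from (Any.any? (λ y → Adj? x y ×-dec walk? y z k) vertices)
    where
    to : Any (λ y → Adj x y × Walk vertexSetoid Adj y z k) vertices → Walk vertexSetoid Adj x z (suc k)
    to p with Any.satisfied p
    ... | _ , a , w = step a w
    from : Walk vertexSetoid Adj x z (suc k) → Any (λ y → Adj x y × Walk vertexSetoid Adj y z k) vertices
    from (step {y = y} a w) =
      Any.map (λ y≈v → proj₁ Adj-resp y≈v a , walk-respˡ y≈v w) (isEnumeration y)

  -- A shortest walk is a path, so this is the path distance.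
  distance : ∀ x y → ∃ λ k →
    Walk vertexSetoid Adj x y k × (∀ m → Walk vertexSetoid Adj x y m → k ≤ m)
  distance x y = least (walk? x y) (proj₂ (connected x y))

  d : Vertex → Vertex → ℕ
  d x y = proj₁ (distance x y)

  B : ℕ → Vertex → Pred Vertex 0ℓ
  B r x y = d x y ≤ r

  B? : ∀ r x → Decidable (B r x)
  B? r x y = d x y ℕ.≤? r

  card : ∀ {P : Pred Vertex 0ℓ} → Decidable P → ℕ
  card P? = length (deduplicate _≟_ (filter P? vertices))

  distinctPairs : List (Vertex × Vertex)
  distinctPairs = filter (λ (x , y) → ¬? (x ≟ y)) (cartesianProduct vertices vertices)

-- The maximum over no pairs at all (a one-vertex graph) is taken to be 0.
N : FiniteConnectedSimpleGraph → ℕ → ℕ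
N Γ r = max 0 (map (λ (x , y) → card (B? r x ∩? B? r y)) distinctPairs)
  where open FiniteConnectedSimpleGraph Γ

permDecSetoid : ℕ → DecSetoid 0ℓ 0ℓ
permDecSetoid n = record
  { Carrier = Permutation′ n
  ; _≈_     = Perm._≈_
  ; isDecEquivalence = record
    { isEquivalence = record
      { refl  = λ _ → refl
      ; sym   = λ p i → sym (p i)
      ; trans = λ p q i → trans (p i) (q i)
      }
    ; _≟_ = λ π ρ → Fin.all? λ i → (π ⟨$⟩ʳ i) Fin.≟ (ρ ⟨$⟩ʳ i)
    }
  }

-- The product is composition of functions, (g · s)(k) = g(s(k)), whereas _∘ₚ_ is diagrammatic.
infixl 7 _·_
_·_ : ∀ {n} → Permutation′ n → Permutation′ n → Permutation′ n
g · s = s ∘ₚ g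

TAdj : ∀ {n} → Rel (Permutation′ n) 0ℓ
TAdj g h = ∃₂ λ i j → i Fin.< j × h Perm.≈ g · transpose i j

perms : ∀ n → List (Permutation′ n)
perms zero    = Perm.id ∷ []
perms (suc n) = cartesianProductWith (insert zero) (allFin (suc n)) (perms n)

private
  insert-cong : ∀ {n} {i j : Fin (suc n)} {π ρ : Permutation′ n} →
                i ≡ j → π Perm.≈ ρ → insert zero i π Perm.≈ insert zero j ρ
  insert-cong refl π≈ρ zero    = refl
  insert-cong {i = i} refl π≈ρ (suc k) = cong (Fin.punchIn i) (π≈ρ k)

perms-isEnumeration : ∀ n → IsEnumeration (DecSetoid.setoid (permDecSetoid n)) (perms n)
perms-isEnumeration zero    π = here λ ()
perms-isEnumeration (suc n) π =
  Membership.∈-resp-≈ (DecSetoid.setoid (permDecSetoid (suc n)))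
    {x = insert zero (π ⟨$⟩ʳ zero) (remove zero π)} {y = π} (insert-remove zero π)
    (Membership.∈-cartesianProductWith⁺ (setoid (Fin (suc n)))
      (DecSetoid.setoid (permDecSetoid n)) (DecSetoid.setoid (permDecSetoid (suc n)))
      (λ {i} {j} {π} {ρ} → insert-cong {i = i} {j} {π} {ρ})
      (≡-Membership.∈-allFin (π ⟨$⟩ʳ zero))
      (perms-isEnumeration n (remove zero π)))

private
  transpose-comm : ∀ {n} (i j k : Fin n) → PC.transpose i j k ≡ PC.transpose j i k
  transpose-comm i j k with k Fin.≟ i in eqᵢ | k Fin.≟ j in eqⱼ
  ... | yes k≡i | yes k≡j = trans (sym k≡j) k≡i
  ... | yes _   | no  _   rewrite eqᵢ = refl
  ... | no  _   | yes _   rewrite eqⱼ = refl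
  ... | no  _   | no  _   rewrite eqᵢ | eqⱼ = refl

  transpose-self : ∀ {n} (i k : Fin n) → PC.transpose i i k ≡ k
  transpose-self i k with k Fin.≟ i
  ... | yes k≡i = sym k≡i
  ... | no k≢i with k Fin.≟ i
  ...   | yes k≡i = contradiction k≡i k≢i
  ...   | no  _   = refl

  transpose-left : ∀ {n} (i j : Fin n) → PC.transpose i j i ≡ j
  transpose-left i j with i Fin.≟ i
  ... | yes _  = refl
  ... | no i≢i = contradiction refl i≢i

  transpose-involutive : ∀ {n} (i j k : Fin n) → PC.transpose i j (PC.transpose i j k) ≡ k
  transpose-involutive i j k =
    trans (cong (PC.transpose i j) (transpose-comm i j k)) (PC.transpose-inverse i j)

  adj-≢ : ∀ {n} {g h : Permutation′ n} {i j} → i ≢ j → h Perm.≈ g · transpose i j → TAdj g h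
  adj-≢ {g = g} {i = i} {j} i≢j p with Fin.<-cmp i j
  ... | tri< i<j _ _ = i , j , i<j , p
  ... | tri≈ _ i≡j _ = contradiction i≡j i≢j
  ... | tri> _ _ j<i = j , i , j<i , λ k → trans (p k) (cong (g ⟨$⟩ʳ_) (transpose-comm i j k))

  TAdj-resp : ∀ {n} → TAdj {n} Respects₂ Perm._≈_
  TAdj-resp = (λ h≈h′ (i , j , i<j , p) → i , j , i<j , λ k → trans (sym (h≈h′ k)) (p k))
            , (λ g≈g′ (i , j , i<j , p) → i , j , i<j , λ k → trans (p k) (g≈g′ _))

  TAdj-sym : ∀ {n} → Symmetric (TAdj {n})
  TAdj-sym {x = g} (i , j , i<j , p) = i , j , i<j , λ k →
    sym (trans (p _) (cong (g ⟨$⟩ʳ_) (transpose-involutive i j k)))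

  TAdj-irrefl : ∀ {n} → Irreflexive Perm._≈_ (TAdj {n})
  TAdj-irrefl {x = g} g≈h (i , j , i<j , p) = Fin.<⇒≢ i<j
    (Injection.injective (↔⇒↣ g)
      (trans (g≈h i) (trans (p i) (cong (g ⟨$⟩ʳ_) (transpose-left i j)))))

  TAdj? : ∀ {n} → Decidable₂ (TAdj {n})
  TAdj? g h = Fin.any? λ i → Fin.any? λ j →
    (i Fin.<? j) ×-dec DecSetoid._≟_ (permDecSetoid _) h (g · transpose i j)

  walk-eval : ∀ {n} (g : Permutation′ n) (ts : TranspositionList n) (h : Permutation′ n) →
              h Perm.≈ g · eval ts → ∃ (Walk (permDecSetoid n) TAdj h g)
  walk-eval g []             h p = 0 , stop p
  walk-eval g ((i , j) ∷ ts) h p with i Fin.≟ j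
  ... | yes refl = walk-eval g ts h λ k →
    trans (p k) (cong (λ l → g · eval ts ⟨$⟩ʳ l) (transpose-self i k))
  ... | no i≢j with walk-eval g ts (g · eval ts) (λ _ → refl)
  ...   | k , w = suc k , step (adj-≢ {g = h} {h = g · eval ts} (i≢j ∘ sym) λ l →
            sym (trans (p _) (cong (λ m → g · eval ts ⟨$⟩ʳ m) (PC.transpose-inverse i j)))) w

  TAdj-connected : ∀ {n} (h g : Permutation′ n) → ∃ (Walk (permDecSetoid n) TAdj h g)
  TAdj-connected h g = walk-eval g (decompose (flip g · h)) h λ k →
    sym (trans (cong (g ⟨$⟩ʳ_) (eval-decompose (flip g · h) k)) (inverseʳ g))

SymT : ℕ → FiniteConnectedSimpleGraph
SymT n = record
  { vertexSetoid  = permDecSetoid n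
  ; Adj           = TAdj
  ; Adj-resp      = (λ {g} {h} {h′} → proj₁ TAdj-resp {g} {h} {h′})
                  , (λ {h} {g} {g′} → proj₂ TAdj-resp {h} {g} {g′})
  ; Adj-sym       = λ {g} {h} → TAdj-sym {x = g} {h}
  ; Adj-irrefl    = λ {g} {h} → TAdj-irrefl {x = g} {h}
  ; Adj?          = TAdj?
  ; vertices      = perms n
  ; isEnumeration = perms-isEnumeration n
  ; connected     = TAdj-connected
  }

{-# OPTIONS --safe #-}

-- Suppose x a ≢ y a, and put b = x⁻¹ (y a), c = y⁻¹ (x a). If z = x·s = y·t with each of s, t a
-- transposition or the identity, then s b = b forces t = (b a), while s b = e ≢ b forces s = (b e),
-- and then either e = a or t = (e a) and e = c. Hence z is one of y·(b a), x·(b a), x·(b c).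
-- The bound is attained by the identity and a 3-cycle, which is a product of two transpositions in
-- three ways.

module Submission where

open import Defs
open import Data.Nat using (ℕ; _≥_)
open import Relation.Binary.PropositionalEquality using (_≡_)

open import Data.Fin.Base as Fin using (Fin; zero; suc)
open import Data.Fin.Patterns using (0F; 1F; 2F)
import Data.Fin.Properties as Fin
open import Data.Fin.Permutation as Perm
  using (Permutation′; _⟨$⟩ʳ_; _⟨$⟩ˡ_; transpose; inverseˡ; inverseʳ)
import Data.Fin.Permutation.Components as PC
open import Data.List.Base using (List; []; _∷_; length; lookup; cartesianProduct)
open import Data.List.Extrema.Nat using (max≤v⁺; v≤max⁺)
import Data.List.Membership.Setoid as Membership
import Data.List.Membership.Setoid.Properties as ∈
open import Data.List.Membership.Propositional using (find; lose)
import Data.List.Membership.Propositional.Properties as ≡-∈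
open import Data.List.Relation.Unary.All as All using (All; []; _∷_)
import Data.List.Relation.Unary.All.Properties as All
open import Data.List.Relation.Unary.AllPairs using ([]; _∷_)
open import Data.List.Relation.Unary.Any as Any using (here; there)
import Data.List.Relation.Unary.Any.Properties as Any
open import Data.List.Relation.Unary.Unique.DecSetoid.Properties using (deduplicate-!)
import Data.List.Relation.Unary.Unique.Setoid as Unique
open import Data.Nat.Base using (suc; _+_; _≤_; z≤n; s≤s)
import Data.Nat.Properties as ℕ
open import Data.Product.Base using (∃₂; _×_; _,_; proj₁; proj₂)
open import Data.Sum.Base using (_⊎_; inj₁; inj₂)
open import Function.Base using (_∘_)
open import Function.Bundles using (Injection)
open import Function.Properties.Inverse using (↔⇒↣)
open import Level using (0ℓ)
open import Relation.Binary.Bundles using (Setoid; DecSetoid)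
open import Relation.Binary.Definitions using (_Respects_)
open import Relation.Binary.PropositionalEquality
  using (_≢_; refl; sym; trans; cong; subst; module ≡-Reasoning)
open import Relation.Nullary.Decidable using (yes; no; ¬?; dec-true; dec-false)
open import Relation.Nullary.Negation using (¬_; contradiction)
open import Relation.Unary using (Pred; Decidable)
open import Relation.Unary.Properties using (_∩?_)

-- Counting entries of lists up to a setoid equality.

module _ (S : Setoid 0ℓ 0ℓ) where
  open Setoid S using (_≈_)
  open Membership S using (_∈_)
  open Unique S using (Unique)

  lookup-distinct : ∀ {xs} → Unique xs → ∀ {i j} → i Fin.< j → ¬ lookup xs i ≈ lookup xs j
  lookup-distinct (x≉xs ∷ _) {zero}  {suc j} _         = All.lookup x≉xs (≡-∈.∈-lookup j)
  lookup-distinct (_ ∷ xs!)  {suc i} {suc j} (s≤s i<j) = lookup-distinct xs! i<j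

  -- Pigeonhole: were `ys` shorter, two positions of `xs` would be matched with the same position of
  -- `ys`, so their entries would be equal.
  unique⇒length≤ : ∀ {xs ys} → Unique xs → All (_∈ ys) xs → length xs ≤ length ys
  unique⇒length≤ {xs} {ys} xs! xs⊆ys = ℕ.≮⇒≥ λ ys<xs →
    let i , j , i<j , eq = Fin.pigeonhole ys<xs (Any.index ∘ member)
    in lookup-distinct xs! i<j (∈.index-injective S (member i) (member j) eq)
    where
    member : ∀ i → lookup xs i ∈ ys
    member i = All.lookup xs⊆ys (≡-∈.∈-lookup i)

-- Balls of radius one and bounds on `N` in an arbitrary graph.

module _ (Γ : FiniteConnectedSimpleGraph) where
  open FiniteConnectedSimpleGraph Γ
  open Membership S using (_∈_)
  open Unique S using (Unique)

  card≤ : ∀ {P : Pred Vertex 0ℓ} (P? : Decidable P) zs → (∀ {z} → P z → z ∈ zs) → card P? ≤ length zs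
  card≤ P? zs P⊆zs = unique⇒length≤ S (deduplicate-! vertexSetoid _)
    (All.deduplicate⁺ _≟_ (All.map P⊆zs (All.all-filter P? vertices)))

  card≥ : ∀ {P : Pred Vertex 0ℓ} (P? : Decidable P) → P Respects _≈_ →
          ∀ {zs} → Unique zs → All P zs → length zs ≤ card P?
  card≥ P? P-resp zs! Pzs = unique⇒length≤ S zs! (All.map (λ {z} Pz →
    ∈.∈-deduplicate⁺ S _≟_ (λ z≈y x≈y → ≈-trans x≈y (≈-sym z≈y))
      (∈.∈-filter⁺ S P? P-resp (isEnumeration z) Pz)) Pzs)

  N≤ : ∀ {r k} → (∀ x y → ¬ x ≈ y → card (B? r x ∩? B? r y) ≤ k) → N Γ r ≤ k
  -- `z≤n` covers the default value 0 of `max`.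
  N≤ bound = max≤v⁺ z≤n (All.map⁺
    {xs = distinctPairs} (All.map (λ {(x , y)} → bound x y)
    (All.all-filter (λ (x , y) → ¬? (x ≟ y)) (cartesianProduct vertices vertices))))

  infix 4 _∼_
  -- The closed neighbourhood: the ball of radius one, stated without the computed distance.
  _∼_ : Vertex → Vertex → Set
  x ∼ z = x ≈ z ⊎ Adj x z

  ∼-respˡ : ∀ {x x′ z} → x ≈ x′ → x ∼ z → x′ ∼ z
  ∼-respˡ x≈x′ (inj₁ x≈z) = inj₁ (≈-trans (≈-sym x≈x′) x≈z)
  ∼-respˡ x≈x′ (inj₂ a)   = inj₂ (proj₂ Adj-resp x≈x′ a)

  ∼-respʳ : ∀ {x z z′} → z ≈ z′ → x ∼ z → x ∼ z′
  ∼-respʳ z≈z′ (inj₁ x≈z) = inj₁ (≈-trans x≈z z≈z′)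
  ∼-respʳ z≈z′ (inj₂ a)   = inj₂ (proj₁ Adj-resp z≈z′ a)

  B₁⇒∼ : ∀ {x z} → B 1 x z → x ∼ z
  B₁⇒∼ {x} {z} = shortWalk (proj₁ (proj₂ (distance x z)))
    where
    shortWalk : ∀ {k} → Walk vertexSetoid Adj x z k → k ≤ 1 → x ∼ z
    shortWalk (stop x≈z)          _ = inj₁ x≈z
    shortWalk (step a (stop y≈z)) _ = inj₂ (proj₁ Adj-resp y≈z a)
    shortWalk (step _ (step _ _)) (s≤s ())

  ∼⇒B₁ : ∀ {x z} → x ∼ z → B 1 x z
  ∼⇒B₁ {x} {z} (inj₁ x≈z) = ℕ.m≤n⇒m≤1+n (proj₂ (proj₂ (distance x z)) 0 (stop x≈z))
  ∼⇒B₁ {x} {z} (inj₂ a)   = proj₂ (proj₂ (distance x z)) 1 (step a (stop ≈-refl))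

  length≤N : ∀ {x y zs} → ¬ x ≈ y → Unique zs → All (λ z → x ∼ z × y ∼ z) zs → length zs ≤ N Γ 1
  length≤N {x} {y} {zs} x≉y zs! x∼zs∼y =
    -- The maximum ranges over listed vertices only, so `x` and `y` are replaced by their
    -- representatives in `vertices`.
    let x′ , x′∈ , x≈x′ = find (isEnumeration x)
        y′ , y′∈ , y≈y′ = find (isEnumeration y)
        x′≉y′ = λ x′≈y′ → x≉y (≈-trans x≈x′ (≈-trans x′≈y′ (≈-sym y≈y′)))
        xy∈ = ≡-∈.∈-filter⁺ (λ (x , y) → ¬? (x ≟ y))
                (≡-∈.∈-cartesianProduct⁺ x′∈ y′∈) x′≉y′
    in v≤max⁺ 0 _ (inj₂ (Any.map⁺ (lose xy∈
         (card≥ (B? 1 x′ ∩? B? 1 y′)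
           (λ z≈z′ (p , q) → ∼⇒B₁ (∼-respʳ z≈z′ (B₁⇒∼ p)) , ∼⇒B₁ (∼-respʳ z≈z′ (B₁⇒∼ q)))
           zs! (All.map (λ (p , q) → ∼⇒B₁ (∼-respˡ x≈x′ p) , ∼⇒B₁ (∼-respˡ y≈y′ q)) x∼zs∼y)))))

transpose-matchˡ : ∀ {n} (i j : Fin n) → PC.transpose i j i ≡ j
transpose-matchˡ i j rewrite dec-true (i Fin.≟ i) refl = refl

transpose-matchʳ : ∀ {n} (i j : Fin n) → PC.transpose i j j ≡ i
transpose-matchʳ i j with j Fin.≟ i
... | yes j≡i = j≡i
... | no _ rewrite dec-true (j Fin.≟ j) refl = refl

transpose-mismatch : ∀ {n} {i j k : Fin n} → k ≢ i → k ≢ j → PC.transpose i j k ≡ k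
transpose-mismatch {i = i} {j} {k} k≢i k≢j
  rewrite dec-false (k Fin.≟ i) k≢i | dec-false (k Fin.≟ j) k≢j = refl

-- Splitting on k ≟ i directly would also abstract it inside PC.transpose i j k.
classify : ∀ {n} (i j k : Fin n) → k ≡ i ⊎ k ≡ j ⊎ (k ≢ i × k ≢ j)
classify i j k with k Fin.≟ i | k Fin.≟ j
... | yes k≡i | _       = inj₁ k≡i
... | no _    | yes k≡j = inj₂ (inj₁ k≡j)
... | no k≢i  | no k≢j  = inj₂ (inj₂ (k≢i , k≢j))

transpose-comm : ∀ {n} (i j k : Fin n) → PC.transpose i j k ≡ PC.transpose j i k
transpose-comm i j k with classify i j k
... | inj₁ refl                = trans (transpose-matchˡ i j) (sym (transpose-matchʳ j i))
... | inj₂ (inj₁ refl)         = trans (transpose-matchʳ i j) (sym (transpose-matchˡ j i))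
... | inj₂ (inj₂ (k≢i , k≢j)) = trans (transpose-mismatch k≢i k≢j) (sym (transpose-mismatch k≢j k≢i))

transpose-involutive : ∀ {n} (i j k : Fin n) → PC.transpose i j (PC.transpose i j k) ≡ k
transpose-involutive i j k =
  trans (cong (PC.transpose i j) (transpose-comm i j k)) (PC.transpose-inverse i j)

-- A moved point `a` must be `i` or `j`, and its image is then the other one.
transpose-unique : ∀ {n} {i j a b : Fin n} → PC.transpose i j a ≡ b → b ≢ a →
                   ∀ k → PC.transpose i j k ≡ PC.transpose a b k
transpose-unique {i = i} {j} {a} eq b≢a k with classify i j a
... | inj₁ refl =
  cong (λ l → PC.transpose a l k) (trans (sym (transpose-matchˡ i j)) eq)
... | inj₂ (inj₁ refl) =
  trans (transpose-comm i a k) (cong (λ l → PC.transpose a l k) (trans (sym (transpose-matchʳ i j)) eq))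
... | inj₂ (inj₂ (a≢i , a≢j)) = contradiction (trans (sym eq) (transpose-mismatch a≢i a≢j)) b≢a

-- The trivial transposition (a a) accounts for z = x.
∼⇒transpose : ∀ {n} {x z : Permutation′ n} (a : Fin n) → _∼_ (SymT n) x z →
              ∃₂ λ i j → z Perm.≈ x · transpose i j
∼⇒transpose {x = x} a (inj₁ x≈z) = a , a , λ k →
  sym (trans (cong (x ⟨$⟩ʳ_) (transpose-self k)) (x≈z k))
  where
  transpose-self : ∀ k → PC.transpose a a k ≡ k
  transpose-self k with classify a a k
  ... | inj₁ refl              = transpose-matchˡ a a
  ... | inj₂ (inj₁ refl)       = transpose-matchˡ a a
  ... | inj₂ (inj₂ (k≢a , _))  = transpose-mismatch k≢a k≢a
∼⇒transpose a (inj₂ (i , j , _ , z≈)) = i , j , z≈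

-- The common part of the unit balls around two permutations that disagree at `a`.

module _ {n} {x y : Permutation′ n} {a : Fin n} (xa≢ya : x ⟨$⟩ʳ a ≢ y ⟨$⟩ʳ a) where
  open Membership (DecSetoid.setoid (permDecSetoid n)) using (_∈_)

  private
    b c : Fin n
    b = x ⟨$⟩ˡ (y ⟨$⟩ʳ a)
    c = y ⟨$⟩ˡ (x ⟨$⟩ʳ a)

    xb≡ya : x ⟨$⟩ʳ b ≡ y ⟨$⟩ʳ a
    xb≡ya = inverseʳ x

    a≢b : a ≢ b
    a≢b a≡b = xa≢ya (trans (cong (x ⟨$⟩ʳ_) a≡b) xb≡ya)

  -- Only a cover of the intersection: entries may coincide. For `y` equal to `x · transpose a b`,
  -- one has `c ≡ b`, and the first and third are both `x`.
  meetingPoints : List (Permutation′ n)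
  meetingPoints = y · transpose b a ∷ x · transpose b a ∷ x · transpose b c ∷ []

  ∈-meetingPoints : ∀ {z} → _∼_ (SymT n) x z → _∼_ (SymT n) y z → z ∈ meetingPoints
  ∈-meetingPoints {z} x∼z y∼z
    with i , j , z≈xs ← ∼⇒transpose {x = x} {z} a x∼z
    with k , l , z≈yt ← ∼⇒transpose {x = y} {z} a y∼z
    = cases
    where
    open ≡-Reasoning

    s t : Fin n → Fin n
    s = PC.transpose i j
    t = PC.transpose k l

    e : Fin n
    e = s b

    -- Both factorisations of `z` are evaluated at `e`; `s` is an involution, so it takes `e` back
    -- to `b`, where `x` has the value of `y` at `a`.
    te≡a : t e ≡ a
    te≡a = Injection.injective (↔⇒↣ y) (begin
      y ⟨$⟩ʳ t e         ≡⟨ z≈yt e ⟨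
      z ⟨$⟩ʳ e           ≡⟨ z≈xs e ⟩
      x ⟨$⟩ʳ s (s b)     ≡⟨ cong (x ⟨$⟩ʳ_) (transpose-involutive i j b) ⟩
      x ⟨$⟩ʳ b           ≡⟨ xb≡ya ⟩
      y ⟨$⟩ʳ a           ∎)

    ≈x·be : e ≢ b → z Perm.≈ x · transpose b e
    ≈x·be e≢b m = trans (z≈xs m) (cong (x ⟨$⟩ʳ_) (transpose-unique refl e≢b m))

    -- Here `s` is the transposition of `b` and `e`, and `t` that of `e` and `a`. The first fixes
    -- `a` and the second takes it to `e`, so evaluating `z` at `a` shows that `y` sends `e` where
    -- `x` sends `a`.
    e≡c : e ≢ b → e ≢ a → e ≡ c
    e≡c e≢b e≢a = trans (sym (inverseˡ y)) (cong (y ⟨$⟩ˡ_) (begin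
      y ⟨$⟩ʳ e                      ≡⟨ cong (y ⟨$⟩ʳ_) (transpose-matchʳ e a) ⟨
      y ⟨$⟩ʳ PC.transpose e a a     ≡⟨ cong (y ⟨$⟩ʳ_) (transpose-unique te≡a (e≢a ∘ sym) a) ⟨
      y ⟨$⟩ʳ t a                    ≡⟨ z≈yt a ⟨
      z ⟨$⟩ʳ a                      ≡⟨ ≈x·be e≢b a ⟩
      x ⟨$⟩ʳ PC.transpose b e a     ≡⟨ cong (x ⟨$⟩ʳ_) (transpose-mismatch a≢b (e≢a ∘ sym)) ⟩
      x ⟨$⟩ʳ a                      ∎))

    cases : z ∈ meetingPoints
    cases with e Fin.≟ b | e Fin.≟ a
    -- With `e ≡ b`, `te≡a` says that `t` moves `b` to `a`, which determines `t`.
    ... | yes e≡b | _       = here λ m → trans (z≈yt m) (cong (y ⟨$⟩ʳ_)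
      (transpose-unique (trans (cong t (sym e≡b)) te≡a) a≢b m))
    ... | no e≢b  | yes e≡a = there (here (subst (λ l → z Perm.≈ x · transpose b l) e≡a (≈x·be e≢b)))
    ... | no e≢b  | no e≢a  =
      there (there (here (subst (λ l → z Perm.≈ x · transpose b l) (e≡c e≢b e≢a) (≈x·be e≢b))))

N≤3 : ∀ n → N (SymT n) 1 ≤ 3
N≤3 n = N≤ (SymT n) λ x y x≉y →
  -- Distinct permutations of a finite set disagree at some point, found by search.
  let a , xa≢ya = Fin.¬∀⟶∃¬ n _ (λ a → x ⟨$⟩ʳ a Fin.≟ y ⟨$⟩ʳ a) x≉y
  in card≤ (SymT n) (B? 1 x ∩? B? 1 y) (meetingPoints {x = x} {y} xa≢ya) λ {z} (p , q) →
       ∈-meetingPoints {x = x} {y} xa≢ya {z} (B₁⇒∼ (SymT n) {x} {z} p) (B₁⇒∼ (SymT n) {y} {z} q)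
  where open FiniteConnectedSimpleGraph (SymT n)

3≤N : ∀ m → 3 ≤ N (SymT (3 + m)) 1
3≤N m = length≤N (SymT _) {Perm.id} {3-cycle} {t₀₁ ∷ t₁₂ ∷ t₀₂ ∷ []}
  -- The point 0 separates everything: the identity and the cycle send it to 0 and 1, and `t₀₁`,
  -- `t₁₂`, `t₀₂` send it to 1, 0 and 2.
  (λ p → contradiction (p 0F) λ ())
  (((λ p → contradiction (p 0F) λ ()) ∷ (λ p → contradiction (p 0F) λ ()) ∷ [])
    ∷ ((λ p → contradiction (p 0F) λ ()) ∷ []) ∷ [] ∷ [])
  -- The cycle is 0 → 1 → 2 → 0. Multiplying it on the right by `t₁₂`, `t₀₂`, `t₀₁` gives `t₀₁`,
  -- `t₁₂`, `t₀₂` respectively; points from 3 on stay fixed.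
  ( ( inj₂ (0F , 1F , s≤s z≤n , λ _ → refl)
    , inj₂ (1F , 2F , s≤s (s≤s z≤n) , λ { 0F → refl ; 1F → refl ; 2F → refl ; (suc (suc (suc _))) → refl }))
  ∷ ( inj₂ (1F , 2F , s≤s (s≤s z≤n) , λ _ → refl)
    , inj₂ (0F , 2F , s≤s z≤n , λ { 0F → refl ; 1F → refl ; 2F → refl ; (suc (suc (suc _))) → refl }))
  ∷ ( inj₂ (0F , 2F , s≤s z≤n , λ _ → refl)
    , inj₂ (0F , 1F , s≤s z≤n , λ { 0F → refl ; 1F → refl ; 2F → refl ; (suc (suc (suc _))) → refl }))
  ∷ [])
  where
  t₀₁ t₁₂ t₀₂ 3-cycle : Permutation′ (3 + m)
  t₀₁ = transpose 0F 1F
  t₁₂ = transpose 1F 2F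
  t₀₂ = transpose 0F 2F
  3-cycle = t₀₁ · t₁₂

theorem3 : (n : ℕ) → n ≥ 3 → N (SymT n) 1 ≡ 3
theorem3 (suc (suc (suc m))) _ = ℕ.≤-antisym (N≤3 (3 + m)) (3≤N m)
theorem3 1 (s≤s ())
theorem3 2 (s≤s (s≤s ()))
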